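{- Let $N$ be a (not necessarily abelian) group, let $\varphi:\mathbb{Z}_2\to\mathrm{Aut}(N)$ be a group homomorphism, and let $G=N\rtimes_\varphi\mathbb{Z}_2$ be a group of (finite) size $n$. Then, for any even $k\ge 4$, every subset of type $(k/2,k/2)$ of $G\setminus\{(0,0)\}$ admits an alternating parity $3$-weak sequencing.
   Context: Groups are written additively, even when non-abelian. The group $N\rtimes_\varphi\mathbb{Z}_2$ has elements $(x,a)$ with $x\in N$, $a\in\mathbb{Z}_2$, and operation $(x_1,a_1)+(x_2,a_2)=(x_1+\varphi(a_1)(x_2),\,a_1+a_2)$; its identity is $(0,0)$. Elements $(x,0)$ are called even and elements $(x,1)$ odd. A finite subset $S$ has type $(\lambda_0,\lambda_1)$ if it contains exactly $\lambda_0$ even elements and $\lambda_1$ odd elements. A $t$-weak sequencing of a set $S$ of size $k$ is an ordering $(y_1,\ldots,y_k)$ of its elements such that the partial sums $s_0=0$ and $s_i=y_1+y_2+\cdots+y_i$ ($1\le i\le k$, sums taken in this order) satisfy $s_i\neq s_j$ for all $0\le i,j\le k$ with $1\le |i-j|\le t$. It is alternating parity if even and odd elements alternate in the ordering, i.e. any two consecutive elements have different parity. -}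

module Defs where

open import Algebra.Bundles using (Group)
open import Algebra.Morphism.Bundles using (GroupHomomorphism)
open import Algebra.Morphism.Structures using (module GroupMorphisms)
import Algebra.Morphism.Construct.Composition as Composition
import Algebra.Morphism.Construct.Identity as Identity
open import Data.List.Base using (List; foldr; length; take)
import Data.List.Membership.Setoid as Membership
open import Data.List.Relation.Unary.Linked using (Linked)
import Data.List.Relation.Unary.Unique.Setoid as UniqueSetoid
open import Data.Nat.Base using (ℕ; _≤_; ∣_-_∣)
open import Data.Parity.Base using (Parity; 0ℙ; 1ℙ)
import Data.Parity.Properties as Parityₚ
open import Data.Product.Base using (_×_; _,_; proj₁; proj₂; ∃)
open import Data.Product.Relation.Binary.Pointwise.NonDependent
  using (Pointwise; ×-isEquivalence)
open import Function.Bundles using (_⇔_)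
open import Level using (Level; 0ℓ; _⊔_)
open import Relation.Binary.PropositionalEquality.Core as ≡ using (_≡_; _≢_)
open import Relation.Unary using (Pred; _∩_; _∈_)

-- The standard library's `+-0-rawGroup` on `Parity` has the parity flip rather
-- than the identity as its inverse, so the raw group is always taken from here.
ℤ₂ : Group 0ℓ 0ℓ
ℤ₂ = Parityₚ.+-0-group

module _ {c ℓ} (N : Group c ℓ) where
  open Group N
  open GroupMorphisms rawGroup rawGroup

  record Automorphism : Set (c ⊔ ℓ) where
    field
      ⟦_⟧                : Carrier → Carrier
      isGroupIsomorphism : IsGroupIsomorphism ⟦_⟧

    open IsGroupIsomorphism isGroupIsomorphism public

    to⁻ : Carrier → Carrier
    to⁻ y = proj₁ (surjective y)

    to∘to⁻ : ∀ y → ⟦ to⁻ y ⟧ ≈ y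
    to∘to⁻ y = proj₂ (surjective y) refl

  open Automorphism using (⟦_⟧)

  private
    invert : Automorphism → Automorphism
    invert f = record
      { ⟦_⟧ = to⁻
      ; isGroupIsomorphism = record
        { isGroupMonomorphism = record
          { isGroupHomomorphism = record
            { isMonoidHomomorphism = record
              { isMagmaHomomorphism = record
                { isRelHomomorphism = record
                  { cong = λ {x} {y} x≈y → injective
                      (trans (to∘to⁻ x) (trans x≈y (sym (to∘to⁻ y)))) }
                ; homo = λ x y → injective (trans (to∘to⁻ (x ∙ y)) (sym
                    (trans (∙-homo (to⁻ x) (to⁻ y)) (∙-cong (to∘to⁻ x) (to∘to⁻ y)))))
                }
              ; ε-homo = injective (trans (to∘to⁻ ε) (sym ε-homo))
              }
            ; ⁻¹-homo = λ x → injective (trans (to∘to⁻ (x ⁻¹)) (sym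
                (trans (⁻¹-homo (to⁻ x)) (⁻¹-cong (to∘to⁻ x)))))
            }
          ; injective = λ {x} {y} eq →
              trans (sym (to∘to⁻ x)) (trans (⟦⟧-cong eq) (to∘to⁻ y))
          }
        ; surjective = λ y → f.⟦ y ⟧ , λ {z} z≈fy → injective (trans (to∘to⁻ z) z≈fy)
        }
      }
      where
        module f = Automorphism f
        open f hiding (⟦_⟧)

  Aut : Group (c ⊔ ℓ) (c ⊔ ℓ)
  Aut = record
    { Carrier = Automorphism
    ; _≈_     = λ f g → ∀ x → ⟦ f ⟧ x ≈ ⟦ g ⟧ x
    ; _∙_     = λ f g → record
        { ⟦_⟧ = λ x → ⟦ f ⟧ (⟦ g ⟧ x)
        ; isGroupIsomorphism = Composition.isGroupIsomorphism trans
            (Automorphism.isGroupIsomorphism g) (Automorphism.isGroupIsomorphism f)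
        }
    ; ε       = record
        { ⟦_⟧ = λ x → x
        ; isGroupIsomorphism = Identity.isGroupIsomorphism rawGroup refl
        }
    ; _⁻¹     = invert
    ; isGroup = record
      { isMonoid = record
        { isSemigroup = record
          { isMagma = record
            { isEquivalence = record
              { refl  = λ x → refl
              ; sym   = λ f≈g x → sym (f≈g x)
              ; trans = λ f≈g g≈h x → trans (f≈g x) (g≈h x)
              }
            ; ∙-cong = λ {f} {f′} {g} {g′} f≈f′ g≈g′ x →
                trans (Automorphism.⟦⟧-cong f (g≈g′ x)) (f≈f′ (⟦ g′ ⟧ x))
            }
          ; assoc = λ f g h x → refl
          }
        ; identity = (λ f x → refl) , (λ f x → refl)
        }
      ; inverse = (λ f x → Automorphism.injective f (Automorphism.to∘to⁻ f (⟦ f ⟧ x)))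
                , (λ f x → Automorphism.to∘to⁻ f x)
      ; ⁻¹-cong = λ {f} {g} f≈g x → Automorphism.injective f
          (trans (Automorphism.to∘to⁻ f x)
          (trans (sym (Automorphism.to∘to⁻ g x)) (sym (f≈g (Automorphism.to⁻ g x)))))
      }
    }

module _ {c ℓ} (N : Group c ℓ)
         (φ : GroupHomomorphism (Group.rawGroup ℤ₂) (Group.rawGroup (Aut N))) where
  private
    module N = Group N
    module Z = Group ℤ₂
    module φ = GroupHomomorphism φ

    act : Parity → N.Carrier → N.Carrier
    act a = Automorphism.⟦ φ.⟦ a ⟧ ⟧

    module Act (a : Parity) = Automorphism φ.⟦ a ⟧

    act-≡ : ∀ {a b} → a ≡ b → ∀ x → act a x N.≈ act b x
    act-≡ ≡.refl x = N.refl

    act-ε : ∀ x → act Z.ε x N.≈ x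
    act-ε = φ.ε-homo

    act-∙ : ∀ a b x → act (a Z.∙ b) x N.≈ act a (act b x)
    act-∙ = φ.homo

  SemidirectProduct : Group c ℓ
  SemidirectProduct = record
    { Carrier = N.Carrier × Parity
    ; _≈_     = Pointwise N._≈_ _≡_
    ; _∙_     = λ (x₁ , a₁) (x₂ , a₂) → x₁ N.∙ act a₁ x₂ , a₁ Z.∙ a₂
    ; ε       = N.ε , Z.ε
    ; _⁻¹     = λ (x , a) → act (a Z.⁻¹) (x N.⁻¹) , a Z.⁻¹
    ; isGroup = record
      { isMonoid = record
        { isSemigroup = record
          { isMagma = record
            { isEquivalence = ×-isEquivalence N.isEquivalence Z.isEquivalence
            ; ∙-cong = λ { {_ , a} (x≈y , ≡.refl) (z≈w , ≡.refl) →
                N.∙-cong x≈y (Act.⟦⟧-cong a z≈w) , ≡.refl }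
            }
          ; assoc = λ (x , a) (y , b) (z , d) →
              N.trans (N.assoc x (act a y) (act (a Z.∙ b) z))
                (N.∙-congˡ (N.trans (N.∙-congˡ (act-∙ a b z))
                  (N.sym (Act.∙-homo a y (act b z)))))
              , Z.assoc a b d
          }
        ; identity = (λ (x , a) → N.trans (N.identityˡ _) (act-ε x) , Z.identityˡ a)
                   , (λ (x , a) → N.trans (N.∙-congˡ (Act.ε-homo a)) (N.identityʳ x)
                                , Z.identityʳ a)
        }
      ; inverse = (λ (x , a) →
                      N.trans (N.sym (Act.∙-homo (a Z.⁻¹) (x N.⁻¹) x))
                        (N.trans (Act.⟦⟧-cong (a Z.⁻¹) (N.inverseˡ x))
                          (Act.ε-homo (a Z.⁻¹)))
                      , Z.inverseˡ a)
                , (λ (x , a) →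
                      N.trans (N.∙-congˡ (N.trans (N.sym (act-∙ a (a Z.⁻¹) (x N.⁻¹)))
                        (N.trans (act-≡ (Z.inverseʳ a) (x N.⁻¹)) (act-ε (x N.⁻¹)))))
                        (N.inverseʳ x)
                      , Z.inverseʳ a)
      ; ⁻¹-cong = λ { {_ , a} (x≈y , ≡.refl) →
          Act.⟦⟧-cong (a Z.⁻¹) (N.⁻¹-cong x≈y) , ≡.refl }
      }
    }

module _ {c ℓ} (G : Group c ℓ) where
  open Group G
  open Membership setoid using () renaming (_∈_ to _∈ₗ_)
  open UniqueSetoid setoid using (Unique)

  -- An ordering of the subset `S`; its existence forces `S` to respect `_≈_`.
  IsOrdering : ∀ {p} → Pred Carrier p → List Carrier → Set (c ⊔ ℓ ⊔ p)
  IsOrdering S ys = Unique ys × (∀ x → x ∈ S ⇔ x ∈ₗ ys)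

  HasSize : ∀ {p} → Pred Carrier p → ℕ → Set (c ⊔ ℓ ⊔ p)
  HasSize S m = ∃ λ ys → IsOrdering S ys × length ys ≡ m

  -- `partialSum ys i` is s_i = y₁ ∙ ⋯ ∙ yᵢ, meaningful for `i ≤ length ys`.
  partialSum : List Carrier → ℕ → Carrier
  partialSum ys i = foldr _∙_ ε (take i ys)

  IsWeakSequencing : ∀ {p} → ℕ → Pred Carrier p → List Carrier → Set (c ⊔ ℓ ⊔ p)
  IsWeakSequencing t S ys =
    IsOrdering S ys ×
    (∀ i j → i ≤ length ys → j ≤ length ys →
     1 ≤ ∣ i - j ∣ → ∣ i - j ∣ ≤ t → partialSum ys i ≉ partialSum ys j)

module _ {c ℓ} (N : Group c ℓ)
         (φ : GroupHomomorphism (Group.rawGroup ℤ₂) (Group.rawGroup (Aut N))) where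
  open Group (SemidirectProduct N φ) using (Carrier)

  parity : Carrier → Parity
  parity = proj₂

  Even Odd : Pred Carrier 0ℓ
  Even y = parity y ≡ 0ℙ
  Odd  y = parity y ≡ 1ℙ

  HasType : ∀ {p} → Pred Carrier p → ℕ → ℕ → Set (c ⊔ ℓ ⊔ p)
  HasType S λ₀ λ₁ =
    HasSize (SemidirectProduct N φ) (S ∩ Even) λ₀ × HasSize (SemidirectProduct N φ) (S ∩ Odd) λ₁

  AlternatingParity : List Carrier → Set c
  AlternatingParity = Linked (λ x y → parity x ≢ parity y)

{-# OPTIONS --safe #-}

-- In an alternating ordering, a block of two elements, or of three elements
-- with even ends, has an odd sum, and no element is zero; so the only
-- constraints concern blocks o, e, o′ with odd ends. Fix the order of the odd
-- elements and place the even ones greedily: the gap between o and o′ forbids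
-- at most one even element, and when it is filled at least two are left. The
-- last even element goes to the end, where there is no constraint.
module Submission where

open import Defs
open import Algebra.Bundles using (Group)
open import Algebra.Morphism.Bundles using (GroupHomomorphism)
import Algebra.Properties.Group as GroupProperties
open import Data.Fin.Base using (Fin)
import Data.Fin.Properties as Fin
open import Data.List.Base using (List; []; _∷_; _++_; length)
import Data.List.Membership.Setoid as Membership
import Data.List.Membership.Setoid.Properties as Membershipₚ
import Data.List.Relation.Binary.Permutation.Setoid as Permutation
import Data.List.Relation.Binary.Permutation.Setoid.Properties as Permutationₚ
open import Data.List.Relation.Unary.All as All using (All; []; _∷_)
open import Data.List.Relation.Unary.AllPairs using ([]; _∷_)
open import Data.List.Relation.Unary.Linked using ([-]; _∷_)
import Data.List.Relation.Unary.Unique.Setoid as UniqueSetoid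
import Data.List.Relation.Unary.Unique.Setoid.Properties as Uniqueₚ
open import Data.Nat.Base using (ℕ; zero; suc; _≤_; s≤s; s≤s⁻¹; ∣_-_∣)
open import Data.Nat.Divisibility using (_∣_)
open import Data.Nat.DivMod using (_/_; /-monoˡ-≤)
open import Data.Nat.Properties using (suc-injective)
open import Data.Parity.Base using (0ℙ; 1ℙ)
open import Data.Product.Base using (_×_; _,_; proj₁; proj₂; ∃; ∃₂)
open import Data.Sum.Base using ([_,_]′)
open import Function.Base using (_∘_)
open import Function.Bundles using (Bijection; Equivalence; mk⇔)
open import Function.Properties.Bijection using (Bijection⇒Inverse)
import Function.Properties.Inverse as Inverseₚ
open import Level using (_⊔_)
open import Relation.Binary.Definitions using (Decidable)
open import Relation.Binary.PropositionalEquality using (setoid; _≡_; refl; subst)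
import Relation.Binary.PropositionalEquality as ≡
open import Relation.Nullary.Decidable using (yes; no; via-injection)
open import Relation.Nullary.Negation using (contradiction)
open import Relation.Unary using (Pred; _⊆_; _∩_)

module _ {c ℓ} (G : Group c ℓ) where
  open Group G hiding (refl)
  open GroupProperties G using (∙-cancelˡ)

  -- Distinctness of partial sums restated suffix by suffix: a prefix of a suffix is a block of
  -- consecutive elements, so each constraint becomes local and can be checked while recursing along
  -- the list.
  data NonzeroBlocks (t : ℕ) : List Carrier → Set (c ⊔ ℓ) where
    []  : NonzeroBlocks t []
    _∷_ : ∀ {y ys} →
          (∀ d → 1 ≤ d → d ≤ t → d ≤ length (y ∷ ys) → partialSum G (y ∷ ys) d ≉ ε) →
          NonzeroBlocks t ys → NonzeroBlocks t (y ∷ ys)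

  -- While both indices are positive, the two sums share their first summand, which cancels on the
  -- left. Once one index reaches `zero`, its sum is `ε` and the other is the sum of a block of
  -- length `∣ i - j ∣`.
  partialSums-distinct : ∀ {t ys} → NonzeroBlocks t ys →
    ∀ i j → i ≤ length ys → j ≤ length ys → 1 ≤ ∣ i - j ∣ → ∣ i - j ∣ ≤ t →
    partialSum G ys i ≉ partialSum G ys j
  partialSums-distinct _ zero zero _ _ () _
  partialSums-distinct (nz ∷ _) zero (suc j) _ j≤ 1≤d d≤t = nz (suc j) 1≤d d≤t j≤ ∘ sym
  partialSums-distinct (nz ∷ _) (suc i) zero i≤ _ 1≤d d≤t = nz (suc i) 1≤d d≤t i≤
  partialSums-distinct (_ ∷ nzs) (suc i) (suc j) i≤ j≤ 1≤d d≤t =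
    partialSums-distinct nzs i j (s≤s⁻¹ i≤) (s≤s⁻¹ j≤) 1≤d d≤t ∘ ∙-cancelˡ _ _ _

module _ {c ℓ} (N : Group c ℓ)
         (φ : GroupHomomorphism (Group.rawGroup ℤ₂) (Group.rawGroup (Aut N))) where

  private
    G : Group c ℓ
    G = SemidirectProduct N φ

  open Group G hiding (refl)
  open GroupProperties G using (∙-cancelˡ; ∙-cancelʳ)
  open Permutation (Group.setoid G)
    using (_↭_; ↭-refl; ↭-sym; ↭-trans; ↭-prep; ↭-swap)
  open Permutationₚ (Group.setoid G)
    using (Unique-resp-↭; All-resp-↭; ∈-resp-↭; xs↭ys⇒|xs|≡|ys|; ↭-shift; ++⁺ˡ)
  open UniqueSetoid (Group.setoid G) using (Unique)
  open Membership (Group.setoid G) using () renaming (_∈_ to _∈ₗ_)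

  private
    NonzeroEven : Pred Carrier ℓ
    NonzeroEven e = Even N φ e × e ≉ ε

    NonzeroEven-resp : ∀ {x y} → x ≈ y → NonzeroEven x → NonzeroEven y
    NonzeroEven-resp x≈y (x-even , x≉ε) =
      ≡.trans (≡.sym (proj₂ x≈y)) x-even , x≉ε ∘ trans x≈y

  odd⇒nonzero : ∀ {x} → Odd N φ x → x ≉ ε
  odd⇒nonzero refl (_ , ())

  -- Built two elements at a time, from an odd start to an even end. Each `step` keeps `o′` as the
  -- head of the tail, so the condition across a gap is stated where both of its odd ends are
  -- visible.
  data Zigzag : List Carrier → Set (c ⊔ ℓ) where
    last : ∀ {o e} → Odd N φ o → NonzeroEven e → Zigzag (o ∷ e ∷ [])
    step : ∀ {o e o′ ys} → Odd N φ o → NonzeroEven e → o ∙ (e ∙ o′) ≉ ε →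
           Zigzag (o′ ∷ ys) → Zigzag (o ∷ e ∷ o′ ∷ ys)

  Zigzag-head-odd : ∀ {o ys} → Zigzag (o ∷ ys) → Odd N φ o
  Zigzag-head-odd (last o-odd _)     = o-odd
  Zigzag-head-odd (step o-odd _ _ _) = o-odd

  Zigzag⇒Alternating : ∀ {ys} → Zigzag ys → AlternatingParity N φ ys
  Zigzag⇒Alternating (last refl (refl , _)) = (λ ()) ∷ [-]
  Zigzag⇒Alternating (step refl (refl , _) _ z) with Zigzag-head-odd z
  ... | refl = (λ ()) ∷ (λ ()) ∷ Zigzag⇒Alternating z

  -- Matching the parity proofs with `refl` lets the parity of a block sum compute, so
  -- `odd⇒nonzero refl` settles every block containing exactly one odd element.
  Zigzag⇒NonzeroBlocks : ∀ {ys} → Zigzag ys → NonzeroBlocks G 3 ys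
  Zigzag⇒NonzeroBlocks (last {o} {e} refl (refl , e≉ε)) = fromOdd ∷ fromEven ∷ []
    where
    fromOdd : ∀ d → 1 ≤ d → d ≤ 3 → d ≤ 2 → partialSum G (o ∷ e ∷ []) d ≉ ε
    fromOdd 1 _ _ _ = odd⇒nonzero refl
    fromOdd 2 _ _ _ = odd⇒nonzero refl
    fromOdd (suc (suc (suc _))) _ _ (s≤s (s≤s ()))
    fromEven : ∀ d → 1 ≤ d → d ≤ 3 → d ≤ 1 → partialSum G (e ∷ []) d ≉ ε
    fromEven 1 _ _ _ = e≉ε ∘ trans (sym (identityʳ e))
    fromEven (suc (suc _)) _ _ (s≤s ())
  Zigzag⇒NonzeroBlocks (step {o} {e} {o′} {ys} refl (refl , e≉ε) oeo′≉ε z) =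
    fromOdd ∷ fromEven z ∷ Zigzag⇒NonzeroBlocks z
    where
    fromOdd : ∀ d → 1 ≤ d → d ≤ 3 → d ≤ length (o ∷ e ∷ o′ ∷ ys) →
              partialSum G (o ∷ e ∷ o′ ∷ ys) d ≉ ε
    fromOdd 1 _ _ _ = odd⇒nonzero refl
    fromOdd 2 _ _ _ = odd⇒nonzero refl
    -- `partialSum` folds down to `ε`, so the sum here is `o ∙ (e ∙ (o′ ∙ ε))`.
    fromOdd 3 _ _ _ = oeo′≉ε ∘ trans (∙-congˡ (∙-congˡ (sym (identityʳ o′))))
    fromOdd (suc (suc (suc (suc _)))) _ (s≤s (s≤s (s≤s ()))) _
    fromEven : ∀ {ys} → Zigzag (o′ ∷ ys) → ∀ d → 1 ≤ d → d ≤ 3 →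
               d ≤ length (e ∷ o′ ∷ ys) → partialSum G (e ∷ o′ ∷ ys) d ≉ ε
    fromEven _ 1 _ _ _ = e≉ε ∘ trans (sym (identityʳ e))
    fromEven z 2 _ _ _ with Zigzag-head-odd z
    ... | refl = odd⇒nonzero refl
    -- The third element of the block is the even successor of `o′`; matching on the zigzag exposes
    -- it, which is why `fromEven` is generalised over the tail.
    fromEven (last refl (refl , _))     3 _ _ _ = odd⇒nonzero refl
    fromEven (step refl (refl , _) _ _) 3 _ _ _ = odd⇒nonzero refl
    fromEven _ (suc (suc (suc (suc _)))) _ (s≤s (s≤s (s≤s ()))) _

  module _ (_≟_ : Decidable _≈_) where

    -- If both `x` and `y` gave `ε` between `a` and `b`, cancelling `a` on the left and `b` on the
    -- right would identify them. So `y` works whenever `x` fails.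
    select : ∀ a b {x y zs} → x ≉ y →
             ∃₂ λ e rest → a ∙ (e ∙ b) ≉ ε × x ∷ y ∷ zs ↭ e ∷ rest
    select a b {x} {y} x≉y with (a ∙ (x ∙ b)) ≟ ε
    ... | no  axb≉ε = x , _ , axb≉ε , ↭-refl
    ... | yes axb≈ε = y , _ ,
      (λ ayb≈ε → x≉y (∙-cancelʳ b x y (∙-cancelˡ a _ _ (trans axb≈ε (sym ayb≈ε))))) ,
      ↭-swap x y ↭-refl

    -- Induction on `os`. Keeping `o` at the head of the result means that the recursive call starts
    -- with `o′`, so the even element chosen between them stays valid. Equal numbers of odd and even
    -- elements guarantee two candidates as long as some `o′` remains.
    arrange : ∀ o os es → All (Odd N φ) (o ∷ os) → All NonzeroEven es → Unique es →
              length es ≡ suc (length os) →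
              ∃ λ ys → Zigzag (o ∷ ys) × (o ∷ os) ++ es ↭ o ∷ ys
    arrange o [] (e ∷ []) (o-odd ∷ []) (e-even ∷ []) _ _ =
      e ∷ [] , last o-odd e-even , ↭-refl
    arrange o (o′ ∷ os) es@(x ∷ y ∷ zs) (o-odd ∷ os-odd) es-even
            es!@((x≉y ∷ _) ∷ _) |es|≡
      with select o o′ {zs = zs} x≉y
    ... | e , rest , oeo′≉ε , es↭e∷rest
      with e-even ∷ rest-even ← All-resp-↭ NonzeroEven-resp es↭e∷rest es-even
         | _ ∷ rest! ← Unique-resp-↭ es↭e∷rest es!
         | |e∷rest|≡ ← ≡.trans (≡.sym (xs↭ys⇒|xs|≡|ys| es↭e∷rest)) |es|≡
      with arrange o′ os rest os-odd rest-even rest! (suc-injective |e∷rest|≡)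
    ... | ys , zigzag , os++rest↭ys =
      e ∷ o′ ∷ ys , step o-odd e-even oeo′≉ε zigzag ,
      -- Bring `e` to the front of the even elements, then move it past the remaining odd ones.
      ↭-prep o (↭-trans (++⁺ˡ (o′ ∷ os) es↭e∷rest)
        (↭-trans (↭-shift (o′ ∷ os) rest) (↭-prep e os++rest↭ys)))

  -- An element has exactly one parity: this makes the two lists disjoint, and case analysis on it
  -- tells which list holds a given element of `S`.
  parity-partition : ∀ {p} {S : Pred Carrier p} {es os ys} →
    IsOrdering G (S ∩ Even N φ) es → IsOrdering G (S ∩ Odd N φ) os →
    os ++ es ↭ ys → IsOrdering G S ys
  parity-partition {S = S} {es} {os} {ys} (es! , S₀⇔es) (os! , S₁⇔os) perm =
    Unique-resp-↭ perm (Uniqueₚ.++⁺ (Group.setoid G) os! es! disjoint) ,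
    λ x → mk⇔ (∈-resp-↭ perm ∘ toAppend x)
              ([ proj₁ ∘ from (S₁⇔os x) , proj₁ ∘ from (S₀⇔es x) ]′
                ∘ Membershipₚ.∈-++⁻ (Group.setoid G) os ∘ ∈-resp-↭ (↭-sym perm))
    where
    open Equivalence using (to; from)

    disjoint : ∀ {x} → x ∈ₗ os × x ∈ₗ es → _
    disjoint {x} (x∈os , x∈es) with proj₂ (from (S₁⇔os x) x∈os) | proj₂ (from (S₀⇔es x) x∈es)
    ... | refl | ()

    toAppend : ∀ x → S x → x ∈ₗ os ++ es
    toAppend x@(_ , 0ℙ) Sx = Membershipₚ.∈-++⁺ʳ (Group.setoid G) os (to (S₀⇔es x) (Sx , refl))
    toAppend x@(_ , 1ℙ) Sx = Membershipₚ.∈-++⁺ˡ (Group.setoid G) (to (S₁⇔os x) (Sx , refl))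

theorem4p1 : ∀ {c ℓ p} (N : Group c ℓ)
    (φ : GroupHomomorphism (Group.rawGroup ℤ₂) (Group.rawGroup (Aut N))) →
    let G = SemidirectProduct N φ in
    (n : ℕ) → Bijection (setoid (Fin n)) (Group.setoid G) →
    (k : ℕ) → 2 ∣ k → 4 ≤ k →
    (S : Pred (Group.Carrier G) p) → S ⊆ (λ y → Group._≉_ G y (Group.ε G)) →
    HasType N φ S (k / 2) (k / 2) →
    ∃ λ (ys : List (Group.Carrier G)) → IsWeakSequencing G 3 S ys × AlternatingParity N φ ys
theorem4p1 N φ n bijection k _ 4≤k S S⊆nonzero
           (_ , ([] , _ , 0≡k/2)) =
  -- `arrange` needs a first odd element; one exists because `4 ≤ k` gives `2 ≤ k / 2`.
  contradiction (subst (2 ≤_) (≡.sym 0≡k/2) (/-monoˡ-≤ 2 4≤k)) λ ()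
theorem4p1 N φ n bijection k _ _ S S⊆nonzero
           ((es , es-ordering@(es! , S₀⇔es) , |es|≡k/2) ,
            (o ∷ os , os-ordering@(_ , S₁⇔os) , |os|≡k/2)) =
  let ys , zigzag , perm = arrange N φ _≟_ o os es os-odd es-even es!
                             (≡.trans |es|≡k/2 (≡.sym |os|≡k/2))
  in
  o ∷ ys ,
  (parity-partition N φ es-ordering os-ordering perm ,
   partialSums-distinct G (Zigzag⇒NonzeroBlocks N φ zigzag)) ,
  Zigzag⇒Alternating N φ zigzag
  where
  G = SemidirectProduct N φ
  open Group G using (_≈_)
  open Equivalence using (from)

  -- Finiteness enters here: equality on `G` is decided by comparing indices in `Fin n`, which lets
  -- `select` test its first candidate.
  _≟_ : Decidable _≈_
  _≟_ = via-injection
    (Inverseₚ.Inverse⇒Injection (Inverseₚ.sym (Bijection⇒Inverse bijection))) Fin._≟_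

  os-odd : All (Odd N φ) (o ∷ os)
  os-odd = All.tabulateₛ (Group.setoid G) (λ {x} → proj₂ ∘ from (S₁⇔os x))

  es-even : All _ es
  es-even = All.tabulateₛ (Group.setoid G) λ {x} x∈es →
    let Sx , x-even = from (S₀⇔es x) x∈es in x-even , S⊆nonzero Sx
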